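{- Let $N$ be a positive integer which is not a perfect square, let $p$ be an integer with $p^2<N$, let $q$ be a positive integer dividing $N-p^2$, and put $\alpha=\frac{\sqrt N+p}{q}$. Then the left-positive path (LPP) of $\alpha$ is an irrationality path, i.e. there exist indices $n<m$ with $x_n=x_m$, where $(x_n)_{n\ge 0}$ is the sequence of numbers in the LPP of $\alpha$; and so $\alpha$ is irrational.
   Context: The Calkin-Wilf tree of $\alpha$ is the infinite binary tree whose root is labeled $\alpha$ and in which every vertex labeled $x$ has a left child labeled $\frac{x}{x+1}$ and a right child labeled $x+1$ (since $\alpha>0$, all labels are positive). Each vertex carries a triple $(\varepsilon,c,d)$ with $\varepsilon\in\{ -1,1\}$, $c$ an integer, $d$ a positive integer dividing $N-c^2$, and label equal to $\frac{\varepsilon\sqrt N+c}{d}$, defined as follows. The root has triple $(1,p,q)$. If a vertex has triple $(\varepsilon,c,d)$, its right child has triple $(\varepsilon,c+d,d)$; its left child has triple $\left(-\varepsilon,\frac{N-c^2}{d}-c,\frac{N-(c+d)^2}{d}\right)$ if $N-(c+d)^2>0$, and $\left(\varepsilon,c-\frac{N-c^2}{d},\frac{(c+d)^2-N}{d}\right)$ otherwise. The left-positive path (LPP) of $\alpha$ is the infinite descending path which starts at the root and which, from each vertex, goes to the left child if the value of $\varepsilon$ for that left child is $1$, and to the right child otherwise. $x_n$ denotes the label of the $n$-th vertex of the LPP, with $x_0=\alpha$. An irrationality path is a path descending from the root of the Calkin-Wilf tree of $\alpha$ that contains the same number at two different vertices. -}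

module Defs where

open import Data.Nat.Base as ℕ using (ℕ; zero; suc)
import Data.Nat.Properties as ℕ
import Data.Nat.Divisibility as ℕ
open import Data.Integer.Base as ℤ using (ℤ; +_; -[1+_]; 0ℤ)
import Data.Integer.Properties as ℤ
import Data.Integer.DivMod as ℤ
open import Data.Integer.Divisibility.Signed using (_∣_; divides; ∣⇒∣ᵤ)
open import Data.Integer.Tactic.RingSolver using () renaming (solve-∀ to solveℤ)
open import Data.Rational.Base
open import Data.Rational.Properties
import Data.Rational.Unnormalised.Base as ℚᵘ
import Data.Rational.Unnormalised.Properties as ℚᵘ
open import Data.Rational.Solver using (module +-*-Solver)
open import Data.Sign.Base as Sign using (Sign)
open import Data.Product.Base using (_×_; _,_; ∃-syntax; proj₁; proj₂)
open import Data.Sum.Base using (_⊎_; inj₁; inj₂)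
open import Relation.Nullary using (¬_; yes; no; contradiction)
open import Relation.Binary.PropositionalEquality
  using (_≡_; _≢_; refl; sym; trans; cong; cong₂; subst; subst₂)

------------------------------------------------------------------------
-- Rational arithmetic

open +-*-Solver using (solve; _:+_; _:*_; _:-_; :-_; _:=_; con)

infix 8 _⁻¹
_⁻¹ : (p : ℚ) → .(0ℚ < p) → ℚ
(p ⁻¹) p>0 = (1/ p) {{>-nonZero p>0}}

+-pos : ∀ {p q} → 0ℚ < p → 0ℚ < q → 0ℚ < p + q
+-pos p>0 q>0 = +-mono-< p>0 q>0

*-mono-pos : ∀ {r p q} → 0ℚ < r → p < q → r * p < r * q
*-mono-pos {r} r>0 = *-monoʳ-<-pos r {{positive r>0}}

*-pos : ∀ {p q} → 0ℚ < p → 0ℚ < q → 0ℚ < p * q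
*-pos {p} {q} p>0 q>0 = subst (_< p * q) (*-zeroʳ p) (*-mono-pos p>0 q>0)

⁻¹-pos : ∀ {p} (p>0 : 0ℚ < p) → 0ℚ < (p ⁻¹) p>0
⁻¹-pos {p} p>0 = positive⁻¹ _ {{1/pos⇒pos p {{positive p>0}}}}

⁻¹-inverse : ∀ {p} (p>0 : 0ℚ < p) → p * (p ⁻¹) p>0 ≡ 1ℚ
⁻¹-inverse {p} p>0 = *-inverseʳ p {{>-nonZero p>0}}

*-mono₂-< : ∀ {a b c d} → 0ℚ < a → a < b → 0ℚ < c → c < d → a * c < b * d
*-mono₂-< {a} {b} {c} {d} a>0 a<b c>0 c<d =
  <-trans (*-mono-pos a>0 c<d) (*-monoˡ-<-pos d {{positive (<-trans c>0 c<d)}} a<b)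

*-mono₂-≤ : ∀ {a b c d} → 0ℚ ≤ a → a ≤ b → 0ℚ ≤ c → c ≤ d → a * c ≤ b * d
*-mono₂-≤ {a} {b} {c} {d} a≥0 a≤b c≥0 c≤d =
  ≤-trans (*-monoˡ-≤-nonNeg a {{nonNegative a≥0}} c≤d)
          (*-monoʳ-≤-nonNeg d {{nonNegative (≤-trans c≥0 c≤d)}} a≤b)

½-pos : 0ℚ < ½
½-pos = positive⁻¹ ½

0<1 : 0ℚ < 1ℚ
0<1 = positive⁻¹ 1ℚ

half+half : ∀ e → ½ * e + ½ * e ≡ e
half+half = solve 1 (λ e → con ½ :* e :+ con ½ :* e := e) refl

p≤∣p∣ : ∀ p → p ≤ ∣ p ∣
p≤∣p∣ p with ≤-total 0ℚ p
... | inj₁ 0≤p = ≤-reflexive (sym (0≤p⇒∣p∣≡p 0≤p))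
... | inj₂ p≤0 = ≤-trans p≤0 (0≤∣p∣ p)

∣∣-< : ∀ {p e} → p < e → - p < e → ∣ p ∣ < e
∣∣-< {p} p<e -p<e with ∣p∣≡p∨∣p∣≡-p p
... | inj₁ eq = subst (_< _) (sym eq) p<e
... | inj₂ eq = subst (_< _) (sym eq) -p<e

<+⇒-< : ∀ {a b e} → a < b + e → a - b < e
<+⇒-< {a} {b} {e} a<b+e =
  subst (a - b <_) (solve 2 (λ b e → b :+ e :- b := e) refl b e) (+-monoˡ-< (- b) a<b+e)

sq-cancel-< : ∀ {a b} → 0ℚ ≤ b → a * a < b * b → a < b
sq-cancel-< {a} {b} b≥0 a²<b² with a <? b
... | yes a<b = a<b
... | no a≮b = contradiction
  (<-≤-trans a²<b² (*-mono₂-≤ b≥0 (≮⇒≥ a≮b) b≥0 (≮⇒≥ a≮b))) (<-irrefl refl)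

------------------------------------------------------------------------
-- Embedding ℤ in ℚ

ℤ→ℚ : ℤ → ℚ
ℤ→ℚ z = z / 1

ratᵘ : ∀ z k → toℚᵘ (z / suc k) ℚᵘ.≃ ℚᵘ.mkℚᵘ z k
ratᵘ z k = toℚᵘ-fromℚᵘ (ℚᵘ.mkℚᵘ z k)

ℤ→ℚ-+ : ∀ y z → ℤ→ℚ (y ℤ.+ z) ≡ ℤ→ℚ y + ℤ→ℚ z
ℤ→ℚ-+ y z = toℚᵘ-injective (ℚᵘ.≃-trans (ratᵘ (y ℤ.+ z) 0) (ℚᵘ.≃-sym
  (ℚᵘ.≃-trans (toℚᵘ-homo-+ (y / 1) (z / 1))
    (ℚᵘ.≃-trans (ℚᵘ.+-cong (ratᵘ y 0) (ratᵘ z 0)) (ℚᵘ.*≡* (lem y z))))))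
  where
  lem : ∀ y z → (y ℤ.* + 1 ℤ.+ z ℤ.* + 1) ℤ.* + 1 ≡ (y ℤ.+ z) ℤ.* + 1
  lem = solveℤ

/-* : ∀ y z k → (y / suc k) * (z / 1) ≡ (y ℤ.* z) / suc k
/-* y z k = toℚᵘ-injective (ℚᵘ.≃-sym (ℚᵘ.≃-trans (ratᵘ (y ℤ.* z) k) (ℚᵘ.≃-sym
  (ℚᵘ.≃-trans (toℚᵘ-homo-* (y / suc k) (z / 1))
    (ℚᵘ.≃-trans (ℚᵘ.*-cong (ratᵘ y k) (ratᵘ z 0))
      (ℚᵘ.*≡* (cong (λ j → y ℤ.* z ℤ.* + suc j) (sym (ℕ.*-identityʳ k)))))))))

ℤ→ℚ-* : ∀ y z → ℤ→ℚ (y ℤ.* z) ≡ ℤ→ℚ y * ℤ→ℚ z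
ℤ→ℚ-* y z = sym (/-* y z 0)

/-cancel : ∀ z k → (z / suc k) * ℤ→ℚ (+ suc k) ≡ ℤ→ℚ z
/-cancel z k = trans (/-* z (+ suc k) k) (toℚᵘ-injective
  (ℚᵘ.≃-trans (ratᵘ (z ℤ.* + suc k) k) (ℚᵘ.≃-trans (ℚᵘ.*≡* (ℤ.*-identityʳ _)) (ℚᵘ.≃-sym (ratᵘ z 0)))))

ℤ→ℚ-mono-≤ : ∀ {y z} → y ℤ.≤ z → ℤ→ℚ y ≤ ℤ→ℚ z
ℤ→ℚ-mono-≤ {y} {z} y≤z = toℚᵘ-cancel-≤
  (ℚᵘ.≤-respˡ-≃ (ℚᵘ.≃-sym (ratᵘ y 0)) (ℚᵘ.≤-respʳ-≃ (ℚᵘ.≃-sym (ratᵘ z 0))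
    (ℚᵘ.*≤* (ℤ.*-monoʳ-≤-nonNeg (+ 1) y≤z))))

ℤ→ℚ-mono-< : ∀ {y z} → y ℤ.< z → ℤ→ℚ y < ℤ→ℚ z
ℤ→ℚ-mono-< {y} {z} y<z = toℚᵘ-cancel-<
  (ℚᵘ.<-respˡ-≃ (ℚᵘ.≃-sym (ratᵘ y 0)) (ℚᵘ.<-respʳ-≃ (ℚᵘ.≃-sym (ratᵘ z 0))
    (ℚᵘ.*<* (ℤ.*-monoʳ-<-pos (+ 1) y<z))))

1/suc : ℕ → ℚ
1/suc n = + 1 / suc n

suc-pos : ∀ n → 0ℚ < ℤ→ℚ (+ suc n)
suc-pos n = ℤ→ℚ-mono-< {0ℤ} {+ suc n} (ℤ.+<+ ℕ.z<s)

1/suc-inverse : ∀ n → 1/suc n * ℤ→ℚ (+ suc n) ≡ 1ℚ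
1/suc-inverse n = /-cancel (+ 1) n

1/suc-pos : ∀ n → 0ℚ < 1/suc n
1/suc-pos n = *-cancelʳ-<-nonNeg (ℤ→ℚ (+ suc n)) {{nonNegative (<⇒≤ (suc-pos n))}}
  (subst₂ _<_ (sym (*-zeroˡ (ℤ→ℚ (+ suc n)))) (sym (1/suc-inverse n)) 0<1)

1/suc-anti : ∀ {m n} → m ℕ.≤ n → 1/suc n ≤ 1/suc m
1/suc-anti {m} {n} m≤n = toℚᵘ-cancel-≤
  (ℚᵘ.≤-respˡ-≃ (ℚᵘ.≃-sym (ratᵘ (+ 1) n)) (ℚᵘ.≤-respʳ-≃ (ℚᵘ.≃-sym (ratᵘ (+ 1) m))
    (ℚᵘ.*≤* (ℤ.*-monoˡ-≤-nonNeg (+ 1) (ℤ.+≤+ (ℕ.s≤s m≤n))))))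

archimedes : ∀ e → 0ℚ < e → ∃[ n ] 1/suc n ≤ e
archimedes e@(mkℚ (+ zero) d _) e>0 with positive {e} e>0
... | ()
archimedes (mkℚ (+ suc k) d _) _ = d , toℚᵘ-cancel-≤
  (ℚᵘ.≤-respˡ-≃ (ℚᵘ.≃-sym (ratᵘ (+ 1) d))
    (ℚᵘ.*≤* (ℤ.*-monoʳ-≤-nonNeg (+ suc d) {+ 1} {+ suc k} (ℤ.+≤+ (ℕ.s≤s ℕ.z≤n)))))
archimedes e@(mkℚ -[1+ k ] d _) e>0 with positive {e} e>0
... | ()

------------------------------------------------------------------------
-- Real numbers as Cauchy sequences of rationals

Cauchy : (ℕ → ℚ) → Set
Cauchy f = ∀ e → 0ℚ < e → ∃[ M ] (∀ m n → M ℕ.≤ m → M ℕ.≤ n → ∣ f m - f n ∣ < e)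

record ℝ : Set where
  constructor real
  field
    approx : ℕ → ℚ
    cauchy : Cauchy approx

open ℝ public

infix 4 _≃ᴿ_

_≃ᴿ_ : ℝ → ℝ → Set
x ≃ᴿ y = ∀ e → 0ℚ < e → ∃[ M ] (∀ n → M ℕ.≤ n → ∣ approx x n - approx y n ∣ < e)

Positiveᴿ : ℝ → Set
Positiveᴿ x = ∃[ δ ] 0ℚ < δ × (∃[ M ] (∀ n → M ℕ.≤ n → δ < approx x n))

ℚ→ℝ : ℚ → ℝ
approx (ℚ→ℝ r) _ = r
cauchy (ℚ→ℝ r) e e>0 = 0 , λ _ _ _ _ → subst (λ z → ∣ z ∣ < e) (sym (+-inverseʳ r)) e>0

ℤ→ℝ : ℤ → ℝ
ℤ→ℝ z = ℚ→ℝ (ℤ→ℚ z)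

Irrational : ℝ → Set
Irrational x = ∀ r → ¬ (x ≃ᴿ ℚ→ℝ r)

joinˡ : ∀ {m n k} → m ℕ.⊔ n ℕ.≤ k → m ℕ.≤ k
joinˡ {m} {n} = ℕ.≤-trans (ℕ.m≤m⊔n m n)

joinʳ : ∀ {m n k} → m ℕ.⊔ n ℕ.≤ k → n ℕ.≤ k
joinʳ {m} {n} = ℕ.≤-trans (ℕ.m≤n⊔m m n)

bounded : ∀ x → ∃[ B ] 0ℚ < B × (∃[ M ] (∀ n → M ℕ.≤ n → ∣ approx x n ∣ < B))
bounded x with cauchy x 1ℚ 0<1
... | M , close = 1ℚ + ∣ approx x M ∣ , <-≤-trans 0<1 (p≤p+q′ (0≤∣p∣ (approx x M))) , M , bound
  where
  p≤p+q′ : ∀ {p q} → 0ℚ ≤ q → p ≤ p + q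
  p≤p+q′ {p} {q} q≥0 = subst (_≤ p + q) (+-identityʳ p) (+-monoʳ-≤ p q≥0)
  split : ∀ a b → a ≡ (a - b) + b
  split = solve 2 (λ a b → a := (a :- b) :+ b) refl
  bound : ∀ n → M ℕ.≤ n → ∣ approx x n ∣ < 1ℚ + ∣ approx x M ∣
  bound n M≤n = ≤-<-trans
    (subst (λ z → ∣ z ∣ ≤ ∣ approx x n - approx x M ∣ + ∣ approx x M ∣)
      (sym (split (approx x n) (approx x M)))
      (∣p+q∣≤∣p∣+∣q∣ (approx x n - approx x M) (approx x M)))
    (+-monoˡ-< ∣ approx x M ∣ (close n M M≤n ℕ.≤-refl))

+-cauchy : ∀ x y → Cauchy (λ n → approx x n + approx y n)
+-cauchy x y e e>0
  with cauchy x (½ * e) (*-pos ½-pos e>0) | cauchy y (½ * e) (*-pos ½-pos e>0)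
... | M₁ , close₁ | M₂ , close₂ = M₁ ℕ.⊔ M₂ , λ m n M≤m M≤n →
  ≤-<-trans
    (subst (λ z → ∣ z ∣ ≤ ∣ approx x m - approx x n ∣ + ∣ approx y m - approx y n ∣)
      (shuffle (approx x m) (approx x n) (approx y m) (approx y n))
      (∣p+q∣≤∣p∣+∣q∣ (approx x m - approx x n) (approx y m - approx y n)))
    (subst (∣ approx x m - approx x n ∣ + ∣ approx y m - approx y n ∣ <_) (half+half e)
      (+-mono-< (close₁ m n (joinˡ M≤m) (joinˡ M≤n)) (close₂ m n (joinʳ {M₁} M≤m) (joinʳ {M₁} M≤n))))
  where
  shuffle : ∀ a b c d → (a - b) + (c - d) ≡ (a + c) - (b + d)
  shuffle = solve 4 (λ a b c d → (a :- b) :+ (c :- d) := (a :+ c) :- (b :+ d)) refl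

*-∣∣-< : ∀ p q {A B} → 0ℚ < A → 0ℚ < B → ∣ p ∣ < A → ∣ q ∣ < B → ∣ p * q ∣ < A * B
*-∣∣-< p q {A} {B} A>0 B>0 p<A q<B = subst (_< A * B) (sym (∣p*q∣≡∣p∣*∣q∣ p q))
  (≤-<-trans {∣ p ∣ * ∣ q ∣} {∣ p ∣ * B} {A * B}
    (*-monoˡ-≤-nonNeg ∣ p ∣ {{nonNegative (0≤∣p∣ p)}} {∣ q ∣} {B} (<⇒≤ q<B))
    (*-monoˡ-<-pos B {{positive B>0}} {∣ p ∣} {A} p<A))

product-close : ∀ a b c d A B h k l → A * k ≡ h → B * l ≡ h →
  0ℚ < A → 0ℚ < B → 0ℚ < k → 0ℚ < l →
  ∣ a ∣ < A → ∣ d ∣ < B → ∣ c - d ∣ < k → ∣ a - b ∣ < l →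
  ∣ a * c - b * d ∣ < h + h
product-close a b c d A B h k l Ak≡h Bl≡h A>0 B>0 k>0 l>0 a<A d<B cd<k ab<l =
  subst (λ z → ∣ z ∣ < h + h) (shuffle a b c d)
    (≤-<-trans {∣ X + Y ∣} {∣ X ∣ + ∣ Y ∣} {h + h} (∣p+q∣≤∣p∣+∣q∣ X Y)
      (+-mono-< {∣ X ∣} {h} {∣ Y ∣} {h}
        (subst (∣ X ∣ <_) Ak≡h (*-∣∣-< a (c - d) {A} {k} A>0 k>0 a<A cd<k))
        (subst (∣ Y ∣ <_) Bl≡h (*-∣∣-< d (a - b) {B} {l} B>0 l>0 d<B ab<l))))
  where
  X = a * (c - d)
  Y = d * (a - b)
  shuffle : ∀ a b c d → a * (c - d) + d * (a - b) ≡ a * c - b * d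
  shuffle = solve 4 (λ a b c d → a :* (c :- d) :+ d :* (a :- b) := a :* c :- b :* d) refl

*-cauchy : ∀ x y → Cauchy (λ n → approx x n * approx y n)
*-cauchy x y e e>0 = combine (bounded x) (bounded y)
  where
  h = ½ * e
  h>0 : 0ℚ < h
  h>0 = *-pos {½} {e} ½-pos e>0
  cancel : ∀ A r → A * r ≡ 1ℚ → A * (h * r) ≡ h
  cancel A r Ar≡1 = trans (solve 3 (λ A h r → A :* (h :* r) := h :* (A :* r)) refl A h r)
    (trans (cong (h *_) Ar≡1) (*-identityʳ h))
  combine : (∃[ A ] 0ℚ < A × (∃[ M ] (∀ n → M ℕ.≤ n → ∣ approx x n ∣ < A))) →
            (∃[ B ] 0ℚ < B × (∃[ M ] (∀ n → M ℕ.≤ n → ∣ approx y n ∣ < B))) →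
            ∃[ M ] (∀ m n → M ℕ.≤ m → M ℕ.≤ n → ∣ approx x m * approx y m - approx x n * approx y n ∣ < e)
  combine (A , A>0 , M₁ , x<A) (B , B>0 , M₂ , y<B) =
    (M₁ ℕ.⊔ M₂) ℕ.⊔ (M₃ ℕ.⊔ M₄) , λ m n M≤m M≤n →
      subst (∣ approx x m * approx y m - approx x n * approx y n ∣ <_) (half+half e)
        (product-close (approx x m) (approx x n) (approx y m) (approx y n) A B h k l
          (cancel A ((A ⁻¹) A>0) (⁻¹-inverse {A} A>0)) (cancel B ((B ⁻¹) B>0) (⁻¹-inverse {B} B>0))
          A>0 B>0 k>0 l>0
          (x<A m (joinˡ {M₁} (joinˡ {M₁ ℕ.⊔ M₂} M≤m)))
          (y<B n (joinʳ {M₁} (joinˡ {M₁ ℕ.⊔ M₂} M≤n)))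
          (proj₂ close₂ m n (joinʳ {M₃} (joinʳ {M₁ ℕ.⊔ M₂} M≤m)) (joinʳ {M₃} (joinʳ {M₁ ℕ.⊔ M₂} M≤n)))
          (proj₂ close₁ m n (joinˡ {M₃} (joinʳ {M₁ ℕ.⊔ M₂} M≤m)) (joinˡ {M₃} (joinʳ {M₁ ℕ.⊔ M₂} M≤n))))
    where
    k = h * (A ⁻¹) A>0
    l = h * (B ⁻¹) B>0
    k>0 : 0ℚ < k
    k>0 = *-pos {h} {(A ⁻¹) A>0} h>0 (⁻¹-pos {A} A>0)
    l>0 : 0ℚ < l
    l>0 = *-pos {h} {(B ⁻¹) B>0} h>0 (⁻¹-pos {B} B>0)
    close₁ = cauchy x l l>0
    close₂ = cauchy y k k>0
    M₃ = proj₁ close₁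
    M₄ = proj₁ close₂

infixl 6 _+ᴿ_
infixl 7 _*ᴿ_

_+ᴿ_ : ℝ → ℝ → ℝ
approx (x +ᴿ y) n = approx x n + approx y n
cauchy (x +ᴿ y) = +-cauchy x y

_*ᴿ_ : ℝ → ℝ → ℝ
approx (x *ᴿ y) n = approx x n * approx y n
cauchy (x *ᴿ y) = *-cauchy x y

-- The value at 0 is arbitrary: an approximation to a positive real vanishes
-- for at most finitely many indices.
recip : ℚ → ℚ
recip p with p ≟ 0ℚ
... | yes _  = 0ℚ
... | no p≢0 = (1/ p) {{≢-nonZero p≢0}}

recip-inverse : ∀ {p} → 0ℚ < p → p * recip p ≡ 1ℚ
recip-inverse {p} p>0 with p ≟ 0ℚ
... | yes p≡0 = contradiction (sym p≡0) (<⇒≢ p>0)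
... | no p≢0  = *-inverseʳ p {{≢-nonZero p≢0}}

recip-cauchy : ∀ x → Positiveᴿ x → Cauchy (λ n → recip (approx x n))
recip-cauchy x (δ , δ>0 , M₁ , δ<x) e e>0 with cauchy x (e * (δ * δ)) (*-pos e>0 (*-pos δ>0 δ>0))
... | M₂ , close = M₁ ℕ.⊔ M₂ , bound
  where
  bound : ∀ m n → M₁ ℕ.⊔ M₂ ℕ.≤ m → M₁ ℕ.⊔ M₂ ℕ.≤ n →
          ∣ recip (approx x m) - recip (approx x n) ∣ < e
  bound m n M≤m M≤n = *-cancelʳ-<-nonNeg (a * b) {{nonNegative (<⇒≤ ab>0)}}
    (subst (_< e * (a * b)) (sym scaled)
      (<-trans (close n m (joinʳ {M₁} M≤n) (joinʳ {M₁} M≤m))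
        (*-mono-pos e>0 (*-mono₂-< δ>0 δ<a δ>0 δ<b))))
    where
    a = approx x m
    b = approx x n
    δ<a = δ<x m (joinˡ M≤m)
    δ<b = δ<x n (joinˡ M≤n)
    a>0 = <-trans δ>0 δ<a
    b>0 = <-trans δ>0 δ<b
    ab>0 = *-pos a>0 b>0
    identity : (recip a - recip b) * (a * b) ≡ b - a
    identity = trans
      (solve 4 (λ a b r s → (r :- s) :* (a :* b) := b :* (a :* r) :- a :* (b :* s)) refl a b (recip a) (recip b))
      (cong₂ _-_ (trans (cong (b *_) (recip-inverse a>0)) (*-identityʳ b))
                 (trans (cong (a *_) (recip-inverse b>0)) (*-identityʳ a)))
    scaled : ∣ recip a - recip b ∣ * (a * b) ≡ ∣ b - a ∣
    scaled = trans (cong (∣ recip a - recip b ∣ *_) (sym (0≤p⇒∣p∣≡p (<⇒≤ ab>0))))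
      (trans (sym (∣p*q∣≡∣p∣*∣q∣ (recip a - recip b) (a * b))) (cong ∣_∣ identity))

+-positive : ∀ x y → Positiveᴿ x → Positiveᴿ y → Positiveᴿ (x +ᴿ y)
+-positive x y (δ₁ , δ₁>0 , M₁ , x>) (δ₂ , δ₂>0 , M₂ , y>) =
  δ₁ + δ₂ , +-pos δ₁>0 δ₂>0 , M₁ ℕ.⊔ M₂ ,
  λ n M≤n → +-mono-< (x> n (joinˡ M≤n)) (y> n (joinʳ {M₁} M≤n))

*-positive : ∀ x y → Positiveᴿ x → Positiveᴿ y → Positiveᴿ (x *ᴿ y)
*-positive x y (δ₁ , δ₁>0 , M₁ , x>) (δ₂ , δ₂>0 , M₂ , y>) =
  δ₁ * δ₂ , *-pos δ₁>0 δ₂>0 , M₁ ℕ.⊔ M₂ ,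
  λ n M≤n → *-mono₂-< δ₁>0 (x> n (joinˡ M≤n)) δ₂>0 (y> n (joinʳ {M₁} M≤n))

record ℝ⁺ : Set where
  constructor _,⁺_
  field
    value   : ℝ
    value>0 : Positiveᴿ value

open ℝ⁺ public using (value)

recipᴿ : ℝ⁺ → ℝ
approx (recipᴿ (x ,⁺ _)) n = recip (approx x n)
cauchy (recipᴿ (x ,⁺ x>0)) = recip-cauchy x x>0

recip-above : ∀ a B r s → 0ℚ < a → 0ℚ < B → a < B → a * r ≡ 1ℚ → B * s ≡ 1ℚ → s < r
recip-above a B r s a>0 B>0 a<B ar≡1 Bs≡1 =
  *-cancelʳ-<-nonNeg (a * B) {{nonNegative (<⇒≤ (*-pos {a} {B} a>0 B>0))}} {s} {r}
    (subst₂ _<_ (sym lhs) (sym rhs) a<B)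
  where
  lhs : s * (a * B) ≡ a
  lhs = trans (solve 3 (λ s a B → s :* (a :* B) := a :* (B :* s)) refl s a B)
    (trans (cong (a *_) Bs≡1) (*-identityʳ a))
  rhs : r * (a * B) ≡ B
  rhs = trans (solve 3 (λ r a B → r :* (a :* B) := B :* (a :* r)) refl r a B)
    (trans (cong (B *_) ar≡1) (*-identityʳ B))

recip-positive : ∀ x → Positiveᴿ (recipᴿ x)
recip-positive (x ,⁺ (δ , δ>0 , M₁ , δ<x)) = combine (bounded x)
  where
  combine : (∃[ B ] 0ℚ < B × (∃[ M ] (∀ n → M ℕ.≤ n → ∣ approx x n ∣ < B))) →
            ∃[ η ] 0ℚ < η × (∃[ M ] (∀ n → M ℕ.≤ n → η < recip (approx x n)))
  combine (B , B>0 , M₂ , x<B) = (B ⁻¹) B>0 , ⁻¹-pos {B} B>0 , M₁ ℕ.⊔ M₂ , bound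
    where
    bound : ∀ n → M₁ ℕ.⊔ M₂ ℕ.≤ n → (B ⁻¹) B>0 < recip (approx x n)
    bound n M≤n = recip-above a B (recip a) ((B ⁻¹) B>0) a>0 B>0
      (≤-<-trans {a} {∣ a ∣} {B} (p≤∣p∣ a) (x<B n (joinʳ {M₁} M≤n)))
      (recip-inverse {a} a>0) (⁻¹-inverse {B} B>0)
      where
      a = approx x n
      a>0 : 0ℚ < a
      a>0 = <-trans {0ℚ} {δ} {a} δ>0 (δ<x n (joinˡ M≤n))

1⁺ : ℝ⁺
1⁺ = ℚ→ℝ 1ℚ ,⁺ (½ , ½-pos , 0 , λ _ _ → ½<1)
  where
  ½<1 : ½ < 1ℚ
  ½<1 = *<* (ℤ.+<+ (ℕ.s≤s (ℕ.s≤s ℕ.z≤n)))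

ℤ→ℝ⁺ : (z : ℤ) → 0ℤ ℤ.< z → ℝ⁺
ℤ→ℝ⁺ z z>0 = ℤ→ℝ z ,⁺
  (½ * ℤ→ℚ z , *-pos ½-pos z>0′ , 0 , λ _ _ →
    subst (½ * ℤ→ℚ z <_) (half+half (ℤ→ℚ z))
      (subst (_< ½ * ℤ→ℚ z + ½ * ℤ→ℚ z) (+-identityʳ (½ * ℤ→ℚ z))
        (+-monoʳ-< (½ * ℤ→ℚ z) (*-pos ½-pos z>0′))))
  where
  z>0′ : 0ℚ < ℤ→ℚ z
  z>0′ = ℤ→ℚ-mono-< {0ℤ} {z} z>0

infixl 6 _+⁺_
infixl 7 _÷⁺_

_+⁺_ : ℝ⁺ → ℝ⁺ → ℝ⁺
(x ,⁺ x>0) +⁺ (y ,⁺ y>0) = (x +ᴿ y) ,⁺ +-positive x y x>0 y>0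

_÷⁺_ : ℝ⁺ → ℝ⁺ → ℝ⁺
(x ,⁺ x>0) ÷⁺ y = (x *ᴿ recipᴿ y) ,⁺ *-positive x (recipᴿ y) x>0 (recip-positive y)

------------------------------------------------------------------------
-- Square roots of natural numbers

-- ⌊ √n ⌋
isqrt : ℕ → ℕ
isqrt zero = zero
isqrt (suc n) with suc (isqrt n) ℕ.* suc (isqrt n) ℕ.≤? suc n
... | yes _ = suc (isqrt n)
... | no  _ = isqrt n

isqrt-lower : ∀ n → isqrt n ℕ.* isqrt n ℕ.≤ n
isqrt-lower zero = ℕ.z≤n
isqrt-lower (suc n) with suc (isqrt n) ℕ.* suc (isqrt n) ℕ.≤? suc n
... | yes le = le
... | no  _  = ℕ.m≤n⇒m≤1+n (isqrt-lower n)

isqrt-upper : ∀ n → n ℕ.< suc (isqrt n) ℕ.* suc (isqrt n)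
isqrt-upper zero = ℕ.z<s
isqrt-upper (suc n) with suc (isqrt n) ℕ.* suc (isqrt n) ℕ.≤? suc n
... | yes _ = ℕ.≤-<-trans (isqrt-upper n) (ℕ.*-mono-< (ℕ.n<1+n (suc (isqrt n))) (ℕ.n<1+n (suc (isqrt n))))
... | no gt = ℕ.≰⇒> gt

-- The n-th approximation to √N is ⌊ (n+1)√N ⌋ / (n+1).
√-approx : ℕ → ℕ → ℚ
√-approx N n = + isqrt (N ℕ.* (suc n ℕ.* suc n)) / suc n

module _ (N n : ℕ) where
  private
    r = isqrt (N ℕ.* (suc n ℕ.* suc n))
    s = √-approx N n
    K = ℤ→ℚ (+ suc n)
    κ = 1/suc n
    N′ = ℤ→ℚ (+ N)

    ι : ℕ → ℚ
    ι k = ℤ→ℚ (+ k)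

    ι-* : ∀ j k → ι (j ℕ.* k) ≡ ι j * ι k
    ι-* j k = trans (cong ℤ→ℚ (ℤ.pos-* j k)) (ℤ→ℚ-* (+ j) (+ k))

    scaleN : ι (N ℕ.* (suc n ℕ.* suc n)) ≡ N′ * (K * K)
    scaleN = trans (ι-* N (suc n ℕ.* suc n)) (cong (N′ *_) (ι-* (suc n) (suc n)))

    sK : s * K ≡ ι r
    sK = /-cancel (+ r) n

    s+κK : (s + κ) * K ≡ ι (suc r)
    s+κK = trans (*-distribʳ-+ K s κ) (trans (cong₂ _+_ sK (1/suc-inverse n))
      (trans (sym (ℤ→ℚ-+ (+ r) (+ 1))) (cong ι (ℕ.+-comm r 1))))

    sq-mul : ∀ a → a * a * (K * K) ≡ (a * K) * (a * K)
    sq-mul a = solve 2 (λ a K → a :* a :* (K :* K) := (a :* K) :* (a :* K)) refl a K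

    K²>0 : 0ℚ < K * K
    K²>0 = *-pos (suc-pos n) (suc-pos n)

  √-approx-≥0 : 0ℚ ≤ √-approx N n
  √-approx-≥0 = *-cancelʳ-≤-pos K {{positive (suc-pos n)}}
    (subst₂ _≤_ (sym (*-zeroˡ K)) (sym sK) (ℤ→ℚ-mono-≤ {0ℤ} {+ r} (ℤ.+≤+ ℕ.z≤n)))

  √-approx-lower : √-approx N n * √-approx N n ≤ ℤ→ℚ (+ N)
  √-approx-lower = *-cancelʳ-≤-pos (K * K) {{positive K²>0}}
    (subst₂ _≤_
      (trans (ι-* r r) (trans (sym (cong₂ _*_ sK sK)) (sym (sq-mul s)))) scaleN
      (ℤ→ℚ-mono-≤ (ℤ.+≤+ (isqrt-lower (N ℕ.* (suc n ℕ.* suc n))))))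

  √-approx-upper : ℤ→ℚ (+ N) < (√-approx N n + 1/suc n) * (√-approx N n + 1/suc n)
  √-approx-upper = *-cancelʳ-<-nonNeg (K * K) {{nonNegative (<⇒≤ K²>0)}}
    (subst₂ _<_ scaleN
      (trans (ι-* (suc r) (suc r)) (trans (sym (cong₂ _*_ s+κK s+κK)) (sym (sq-mul (s + κ)))))
      (ℤ→ℚ-mono-< (ℤ.+<+ (isqrt-upper (N ℕ.* (suc n ℕ.* suc n))))))

√-approx-close : ∀ N m n → √-approx N m < √-approx N n + 1/suc n
√-approx-close N m n = sq-cancel-<
  (+-mono-≤ (√-approx-≥0 N n) (<⇒≤ (1/suc-pos n)))
  (≤-<-trans (√-approx-lower N m) (√-approx-upper N n))

√-cauchy : ∀ N → Cauchy (√-approx N)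
√-cauchy N e e>0 with archimedes e e>0
... | M , 1/M≤e = M , λ m n M≤m M≤n →
  ∣∣-< (<-≤-trans (<+⇒-< {b = √-approx N n} (√-approx-close N m n)) (≤-trans (1/suc-anti M≤n) 1/M≤e))
       (subst (_< e) (flip (√-approx N m) (√-approx N n))
         (<-≤-trans (<+⇒-< {b = √-approx N m} (√-approx-close N n m)) (≤-trans (1/suc-anti M≤m) 1/M≤e)))
  where
  flip : ∀ a b → b - a ≡ - (a - b)
  flip = solve 2 (λ a b → b :- a := :- (a :- b)) refl

infix 8 √_

√_ : ℕ → ℝ
√ N = real (√-approx N) (√-cauchy N)

√-square : ∀ N → (√ N *ᴿ √ N) ≃ᴿ ℤ→ℝ (+ N)
√-square N e e>0 = combine (archimedes (e * (C ⁻¹) C>0) (*-pos {e} {(C ⁻¹) C>0} e>0 (⁻¹-pos {C} C>0)))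
  where
  C = ℤ→ℚ (+ (suc N ℕ.+ suc N ℕ.+ 1))
  C>0 : 0ℚ < C
  C>0 = suc-pos (N ℕ.+ suc N ℕ.+ 1)
  B = ℤ→ℚ (+ suc N)
  C≡ : C ≡ B + B + 1ℚ
  C≡ = trans (ℤ→ℚ-+ (+ (suc N ℕ.+ suc N)) (+ 1)) (cong (_+ 1ℚ) (ℤ→ℚ-+ (+ suc N) (+ suc N)))
  N<B² : ℤ→ℚ (+ N) < B * B
  N<B² = subst (ℤ→ℚ (+ N) <_) (trans (cong ℤ→ℚ (ℤ.pos-* (suc N) (suc N))) (ℤ→ℚ-* (+ suc N) (+ suc N)))
    (ℤ→ℚ-mono-< {+ N} {+ (suc N ℕ.* suc N)} (ℤ.+<+ (ℕ.m≤m*n (suc N) (suc N))))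
  bound : ∀ M → 1/suc M ≤ e * (C ⁻¹) C>0 → ∀ n → M ℕ.≤ n → ∣ √-approx N n * √-approx N n - ℤ→ℚ (+ N) ∣ < e
  bound M κ≤ n M≤n = ∣∣-<
    (≤-<-trans (subst (s * s - ℤ→ℚ (+ N) ≤_) (+-inverseʳ (ℤ→ℚ (+ N)))
      (+-monoˡ-≤ (- ℤ→ℚ (+ N)) (√-approx-lower N n))) e>0)
    (subst (_< e) (solve 2 (λ N s → N :- s := :- (s :- N)) refl (ℤ→ℚ (+ N)) (s * s))
      (<-≤-trans (<+⇒-< {b = s * s} (subst (ℤ→ℚ (+ N) <_) (expand s κ) (√-approx-upper N n))) small))
    where
    s = √-approx N n
    κ = 1/suc n
    expand : ∀ s κ → (s + κ) * (s + κ) ≡ s * s + κ * (s + s + κ)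
    expand = solve 2 (λ s κ → (s :+ κ) :* (s :+ κ) := s :* s :+ κ :* (s :+ s :+ κ)) refl
    s<B : s < B
    s<B = sq-cancel-< (<⇒≤ (suc-pos N)) (≤-<-trans (√-approx-lower N n) N<B²)
    factor≤C : s + s + κ ≤ C
    factor≤C = subst (s + s + κ ≤_) (sym C≡)
      (+-mono-≤ (+-mono-≤ (<⇒≤ s<B) (<⇒≤ s<B)) (1/suc-anti {0} {n} ℕ.z≤n))
    small : κ * (s + s + κ) ≤ e
    small = subst (κ * (s + s + κ) ≤_)
      (trans (solve 3 (λ e r C → (e :* r) :* C := e :* (C :* r)) refl e ((C ⁻¹) C>0) C)
        (trans (cong (e *_) (⁻¹-inverse C>0)) (*-identityʳ e)))
      (*-mono₂-≤ (<⇒≤ (1/suc-pos n)) (≤-trans (1/suc-anti M≤n) κ≤)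
        (+-mono-≤ (+-mono-≤ (√-approx-≥0 N n) (√-approx-≥0 N n)) (<⇒≤ (1/suc-pos n))) factor≤C)
  combine : (∃[ M ] 1/suc M ≤ e * (C ⁻¹) C>0) →
            ∃[ M ] (∀ n → M ℕ.≤ n → ∣ √-approx N n * √-approx N n - ℤ→ℚ (+ N) ∣ < e)
  combine (M , κ≤) = M , bound M κ≤

√N+p-positive : ∀ N p → p ℤ.* p ℤ.< + N → Positiveᴿ (√ N +ᴿ ℤ→ℝ p)
√N+p-positive N p p²<N = η , 1/suc-pos j , j , λ n j≤n →
  subst (_< √-approx N n + ℤ→ℚ p) (cancel (ℤ→ℚ t) (ℤ→ℚ p) η)
    (≤-<-trans (+-monoˡ-≤ (ℤ→ℚ p) (+-monoˡ-≤ η (neg≤t)))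
      (+-monoˡ-< (ℤ→ℚ p) (above n j≤n)))
  where
  t = + ℤ.∣ p ∣
  T = ℤ→ℚ t
  j = 3 ℕ.+ 4 ℕ.* ℤ.∣ p ∣
  η = 1/suc j
  cancel : ∀ T p η → (- p + η) + p ≡ η
  cancel = solve 3 (λ T p η → (:- p :+ η) :+ p := η) refl
  T≥0 : 0ℚ ≤ T
  T≥0 = ℤ→ℚ-mono-≤ {0ℤ} {t} (ℤ.+≤+ ℕ.z≤n)
  z+∣z∣≥0 : ∀ z → 0ℤ ℤ.≤ z ℤ.+ + ℤ.∣ z ∣
  z+∣z∣≥0 (+ _)    = ℤ.+≤+ ℕ.z≤n
  z+∣z∣≥0 -[1+ k ] = ℤ.≤-reflexive (sym (ℤ.+-inverseˡ (+ suc k)))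
  neg≤t : - ℤ→ℚ p ≤ T
  neg≤t = subst₂ _≤_ (+-identityʳ (- ℤ→ℚ p))
    (solve 2 (λ p t → :- p :+ (p :+ t) := t) refl (ℤ→ℚ p) T)
    (+-monoʳ-≤ (- ℤ→ℚ p) (subst (0ℚ ≤_) (ℤ→ℚ-+ p t) (ℤ→ℚ-mono-≤ {0ℤ} {p ℤ.+ t} (z+∣z∣≥0 p))))
  ∣z∣²≡z² : ∀ z → + ℤ.∣ z ∣ ℤ.* + ℤ.∣ z ∣ ≡ z ℤ.* z
  ∣z∣²≡z² (+ _)    = refl
  ∣z∣²≡z² -[1+ _ ] = refl
  1+t²≤N : 1ℚ + T * T ≤ ℤ→ℚ (+ N)
  1+t²≤N = subst (_≤ ℤ→ℚ (+ N))
    (trans (cong (λ z → ℤ→ℚ (+ 1 ℤ.+ z)) (sym (∣z∣²≡z² p))) (trans (ℤ→ℚ-+ (+ 1) (t ℤ.* t)) (cong (λ z → 1ℚ + z) (ℤ→ℚ-* t t))))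
    (ℤ→ℚ-mono-≤ {+ 1 ℤ.+ p ℤ.* p} {+ N} (ℤ.i<j⇒suc[i]≤j p²<N))
  four = ℤ→ℚ (+ 4)
  j+1≡ : ℤ→ℚ (+ suc j) ≡ four + four * T
  j+1≡ = trans (ℤ→ℚ-+ (+ 4) (+ (4 ℕ.* ℤ.∣ p ∣)))
    (cong (λ z → four + z) (trans (cong ℤ→ℚ (ℤ.pos-* 4 ℤ.∣ p ∣)) (ℤ→ℚ-* (+ 4) t)))
  η-inverse : η * (four + four * T) ≡ 1ℚ
  η-inverse = trans (cong (η *_) (sym j+1≡)) (1/suc-inverse j)
  square≤ : (T + η + η) * (T + η + η) ≤ ℤ→ℚ (+ N)
  square≤ = ≤-trans
    (subst₂ _≤_
      (solve 2 (λ T η → η :* (con four :* η :+ con four :* T) :+ T :* T := (T :+ η :+ η) :* (T :+ η :+ η)) refl T η)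
      refl
      (+-monoˡ-≤ (T * T) (*-mono₂-≤ (<⇒≤ (1/suc-pos j)) ≤-refl
        (+-mono-≤ {0ℚ} {four * η} {0ℚ} {four * T}
          (four*≥0 (<⇒≤ (1/suc-pos j))) (four*≥0 T≥0))
        (+-monoˡ-≤ (four * T) (four*≤ (1/suc-anti {0} {j} ℕ.z≤n))))))
    (subst (_≤ ℤ→ℚ (+ N)) (cong (_+ T * T) (sym η-inverse)) 1+t²≤N)
    where
    four*≤ : ∀ {a} → a ≤ 1ℚ → four * a ≤ four
    four*≤ {a} a≤1 = subst (four * a ≤_) (*-identityʳ four) (*-monoˡ-≤-nonNeg four a≤1)
    four*≥0 : ∀ {a} → 0ℚ ≤ a → 0ℚ ≤ four * a
    four*≥0 {a} a≥0 = subst (_≤ four * a) (*-zeroʳ four) (*-monoˡ-≤-nonNeg four a≥0)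
  above : ∀ n → j ℕ.≤ n → T + η < √-approx N n
  above n j≤n with T + η <? √-approx N n
  ... | yes lt = lt
  ... | no ≮ = contradiction
    (<-≤-trans (√-approx-upper N n) (≤-trans (*-mono₂-≤ u≥0 u≤ u≥0 u≤) square≤)) (<-irrefl refl)
    where
    u≥0 : 0ℚ ≤ √-approx N n + 1/suc n
    u≥0 = +-mono-≤ (√-approx-≥0 N n) (<⇒≤ (1/suc-pos n))
    u≤ : √-approx N n + 1/suc n ≤ T + η + η
    u≤ = +-mono-≤ (≮⇒≥ ≮) (1/suc-anti j≤n)

-- (√N + p) / q
surd : (N : ℕ) (p q : ℤ) → p ℤ.* p ℤ.< + N → 0ℤ ℤ.< q → ℝ⁺
surd N p q p²<N q>0 =
  ((√ N +ᴿ ℤ→ℝ p) ,⁺ √N+p-positive N p p²<N) ÷⁺ ℤ→ℝ⁺ q q>0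

------------------------------------------------------------------------
-- The Calkin–Wilf tree

data Vertex : Set where
  root       : Vertex
  leftChild  : Vertex → Vertex
  rightChild : Vertex → Vertex

label : ℝ⁺ → Vertex → ℝ⁺
label α root           = α
label α (leftChild v)  = label α v ÷⁺ (label α v +⁺ 1⁺)
label α (rightChild v) = label α v +⁺ 1⁺

record DescendingPath : Set where
  field
    vertex     : ℕ → Vertex
    startsRoot : vertex 0 ≡ root
    descends   : ∀ n → vertex (suc n) ≡ leftChild (vertex n) ⊎ vertex (suc n) ≡ rightChild (vertex n)

open DescendingPath public using (vertex)

-- Positions n < m on a descending path lie at different depths, so they are
-- different vertices.
IsIrrationalityPath : ℝ⁺ → DescendingPath → Set
IsIrrationalityPath α P =
  ∃[ n ] ∃[ m ] n ℕ.< m × value (label α (vertex P n)) ≃ᴿ value (label α (vertex P m))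

------------------------------------------------------------------------
-- Triples

NonSquare : ℕ → Set
NonSquare N = ¬ (∃[ k ] N ≡ k ℕ.* k)

-- The triple (ε, c, d) stands for the number (ε√N + c) / d.
record Triple (N : ℕ) : Set where
  constructor triple
  field
    ε      : Sign
    c d    : ℤ
    d>0    : 0ℤ ℤ.< d
    d∣N-c² : d ∣ + N ℤ.- c ℤ.* c

-- The quotient a / d; only ever used when d divides a.
div : (a d : ℤ) → 0ℤ ℤ.< d → ℤ
div a d d>0 = (a ℤ./ d) {{ℤ.>-nonZero d>0}}

div-exact : ∀ {a d} (d>0 : 0ℤ ℤ.< d) → d ∣ a → a ≡ div a d d>0 ℤ.* d
div-exact {a} {d} d>0 d∣a@(divides k a≡kd) =
  trans a≡r+qd (trans (cong (λ r → + r ℤ.+ div a d d>0 ℤ.* d) r≡0) (ℤ.+-identityˡ _))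
  where
  instance _ = ℤ.>-nonZero d>0
  a≡r+qd : a ≡ + (a ℤ.% d) ℤ.+ (a ℤ./ d) ℤ.* d
  a≡r+qd = ℤ.a≡a%n+[a/n]*n a d
  remainder : ∀ a r q k d → a ≡ k ℤ.* d → a ≡ r ℤ.+ q ℤ.* d → r ≡ (k ℤ.- q) ℤ.* d
  remainder a r q k d e₁ e₂ = trans (solve₁ r q d) (trans (cong (ℤ._- q ℤ.* d) (trans (sym e₂) e₁)) (solve₂ k q d))
    where
    solve₁ : ∀ r q d → r ≡ (r ℤ.+ q ℤ.* d) ℤ.- q ℤ.* d
    solve₁ = solveℤ
    solve₂ : ∀ k q d → k ℤ.* d ℤ.- q ℤ.* d ≡ (k ℤ.- q) ℤ.* d
    solve₂ = solveℤ
  d∣r : d ∣ + (a ℤ.% d)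
  d∣r = divides (k ℤ.- (a ℤ./ d)) (remainder a (+ (a ℤ.% d)) (a ℤ./ d) k d a≡kd a≡r+qd)
  r≡0 : a ℤ.% d ≡ 0
  r≡0 with a ℤ.% d | ∣⇒∣ᵤ d∣r | ℤ.n%d<d a d
  ... | zero  | _   | _   = refl
  ... | suc r | d∣r | r<d = contradiction d∣r (ℕ.>⇒∤ r<d)

div-pos : ∀ {a d} (d>0 : 0ℤ ℤ.< d) → d ∣ a → 0ℤ ℤ.< a → 0ℤ ℤ.< div a d d>0
div-pos {a} {d} d>0 d∣a a>0 = ℤ.*-cancelʳ-<-nonNeg d {{ℤ.nonNegative (ℤ.<⇒≤ d>0)}}
  (subst₂ ℤ._<_ (sym (ℤ.*-zeroˡ d)) (div-exact d>0 d∣a) a>0)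

shift : ∀ N c d e → N ℤ.- c ℤ.* c ≡ e ℤ.* d →
        N ℤ.- (c ℤ.+ d) ℤ.* (c ℤ.+ d) ≡ (e ℤ.- c ℤ.- c ℤ.- d) ℤ.* d
shift N c d e eq = trans (expand N c d) (trans (cong (ℤ._- (c ℤ.+ c ℤ.+ d) ℤ.* d) eq) (collect c d e))
  where
  expand : ∀ N c d → N ℤ.- (c ℤ.+ d) ℤ.* (c ℤ.+ d) ≡ (N ℤ.- c ℤ.* c) ℤ.- (c ℤ.+ c ℤ.+ d) ℤ.* d
  expand = solveℤ
  collect : ∀ c d e → e ℤ.* d ℤ.- (c ℤ.+ c ℤ.+ d) ℤ.* d ≡ (e ℤ.- c ℤ.- c ℤ.- d) ℤ.* d
  collect = solveℤ

module _ {N : ℕ} where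

  shift-∣ : ∀ {c d} → d ∣ + N ℤ.- c ℤ.* c → d ∣ + N ℤ.- (c ℤ.+ d) ℤ.* (c ℤ.+ d)
  shift-∣ {c} {d} (divides e eq) = divides (e ℤ.- c ℤ.- c ℤ.- d) (shift (+ N) c d e eq)

  flip-∣ : ∀ {c d} → d ∣ + N ℤ.- (c ℤ.+ d) ℤ.* (c ℤ.+ d) → d ∣ (c ℤ.+ d) ℤ.* (c ℤ.+ d) ℤ.- + N
  flip-∣ {c} {d} (divides f eq) = divides (ℤ.- f)
    (trans (swap ((c ℤ.+ d) ℤ.* (c ℤ.+ d)) (+ N)) (trans (cong ℤ.-_ eq) (ℤ.neg-distribˡ-* f d)))
    where
    swap : ∀ x y → x ℤ.- y ≡ ℤ.- (y ℤ.- x)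
    swap = solveℤ

  -- With e d = N − c² and f d = N − (c+d)²: N − (e−c)² = −e f.
  norm : ∀ {c d e f} → 0ℤ ℤ.< d → + N ℤ.- c ℤ.* c ≡ e ℤ.* d →
         + N ℤ.- (c ℤ.+ d) ℤ.* (c ℤ.+ d) ≡ f ℤ.* d →
         + N ℤ.- (e ℤ.- c) ℤ.* (e ℤ.- c) ≡ (ℤ.- e) ℤ.* f
  norm {c} {d} {e} {f} d>0 eq₁ eq₂ =
    trans (expand (+ N) c e) (trans (cong (ℤ._+ (e ℤ.* c ℤ.+ e ℤ.* c ℤ.- e ℤ.* e)) eq₁)
      (trans (collect c d e) (cong (ℤ.- e ℤ.*_) (sym f≡))))
    where
    f≡ : f ≡ e ℤ.- c ℤ.- c ℤ.- d
    f≡ = ℤ.*-cancelʳ-≡ f _ d {{ℤ.>-nonZero d>0}} (trans (sym eq₂) (shift (+ N) c d e eq₁))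
    expand : ∀ N c e → N ℤ.- (e ℤ.- c) ℤ.* (e ℤ.- c) ≡ (N ℤ.- c ℤ.* c) ℤ.+ (e ℤ.* c ℤ.+ e ℤ.* c ℤ.- e ℤ.* e)
    expand = solveℤ
    collect : ∀ c d e → e ℤ.* d ℤ.+ (e ℤ.* c ℤ.+ e ℤ.* c ℤ.- e ℤ.* e) ≡ ℤ.- e ℤ.* (e ℤ.- c ℤ.- c ℤ.- d)
    collect = solveℤ

  norm′ : ∀ {c d e f} → 0ℤ ℤ.< d → + N ℤ.- c ℤ.* c ≡ e ℤ.* d →
          (c ℤ.+ d) ℤ.* (c ℤ.+ d) ℤ.- + N ≡ f ℤ.* d →
          + N ℤ.- (c ℤ.- e) ℤ.* (c ℤ.- e) ≡ e ℤ.* f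
  norm′ {c} {d} {e} {f} d>0 eq₁ eq₂ =
    trans (reverse (+ N) c e) (trans (norm {c} {d} {e} {ℤ.- f} d>0 eq₁
      (trans (swap (+ N) ((c ℤ.+ d) ℤ.* (c ℤ.+ d))) (trans (cong ℤ.-_ eq₂) (ℤ.neg-distribˡ-* f d))))
      (negneg e f))
    where
    reverse : ∀ N c e → N ℤ.- (c ℤ.- e) ℤ.* (c ℤ.- e) ≡ N ℤ.- (e ℤ.- c) ℤ.* (e ℤ.- c)
    reverse = solveℤ
    swap : ∀ x y → x ℤ.- y ≡ ℤ.- (y ℤ.- x)
    swap = solveℤ
    negneg : ∀ e f → ℤ.- e ℤ.* ℤ.- f ≡ e ℤ.* f
    negneg = solveℤ

module _ {N : ℕ} (nonSquare : NonSquare N) where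

  difference≢0 : ∀ x → + N ℤ.- x ℤ.* x ≢ 0ℤ
  difference≢0 x eq = nonSquare (ℤ.∣ x ∣ , trans (cong ℤ.∣_∣ (ℤ.i-j≡0⇒i≡j (+ N) (x ℤ.* x) eq)) (ℤ.abs-* x x))

  ≯0⇒flip>0 : ∀ x → ¬ (0ℤ ℤ.< + N ℤ.- x ℤ.* x) → 0ℤ ℤ.< x ℤ.* x ℤ.- + N
  ≯0⇒flip>0 x ≯0 = subst (0ℤ ℤ.<_) (swap (+ N) (x ℤ.* x))
    (ℤ.neg-mono-< (ℤ.≤∧≢⇒< (ℤ.≮⇒≥ ≯0) (difference≢0 x)))
    where
    swap : ∀ x y → ℤ.- (x ℤ.- y) ≡ y ℤ.- x
    swap = solveℤ

  rightTriple : Triple N → Triple N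
  rightTriple (triple ε c d d>0 d∣) = triple ε (c ℤ.+ d) d d>0 (shift-∣ {N} {c} {d} d∣)

  leftTriple : Triple N → Triple N
  leftTriple (triple ε c d d>0 d∣) with 0ℤ ℤ.<? + N ℤ.- (c ℤ.+ d) ℤ.* (c ℤ.+ d)
  ... | yes >0 = triple (Sign.opposite ε) (e ℤ.- c) d′ (div-pos d>0 d∣′ >0)
    (divides (ℤ.- e) (norm {N} {c} {d} {e} {d′} d>0 (div-exact d>0 d∣) (div-exact d>0 d∣′)))
    where
    e = div (+ N ℤ.- c ℤ.* c) d d>0
    d′ = div (+ N ℤ.- (c ℤ.+ d) ℤ.* (c ℤ.+ d)) d d>0
    d∣′ = shift-∣ {N} {c} {d} d∣
  ... | no ≯0 = triple ε (c ℤ.- e) d′ (div-pos d>0 d∣′ (≯0⇒flip>0 (c ℤ.+ d) ≯0))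
    (divides e (norm′ {N} {c} {d} {e} {d′} d>0 (div-exact d>0 d∣) (div-exact d>0 d∣′)))
    where
    e = div (+ N ℤ.- c ℤ.* c) d d>0
    d′ = div ((c ℤ.+ d) ℤ.* (c ℤ.+ d) ℤ.- + N) d d>0
    d∣′ = flip-∣ {N} {c} {d} (shift-∣ {N} {c} {d} d∣)

  tripleAt : Triple N → Vertex → Triple N
  tripleAt t root           = t
  tripleAt t (leftChild v)  = leftTriple (tripleAt t v)
  tripleAt t (rightChild v) = rightTriple (tripleAt t v)

  nextLPP : Triple N → Vertex → Vertex
  nextLPP t v with Triple.ε (tripleAt t (leftChild v))
  ... | Sign.+ = leftChild v
  ... | Sign.- = rightChild v

  LPP : Triple N → DescendingPath
  LPP t = record
    { vertex     = go
    ; startsRoot = refl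
    ; descends   = λ n → next-child (go n)
    }
    where
    go : ℕ → Vertex
    go zero    = root
    go (suc n) = nextLPP t (go n)
    next-child : ∀ v → nextLPP t v ≡ leftChild v ⊎ nextLPP t v ≡ rightChild v
    next-child v with Triple.ε (tripleAt t (leftChild v))
    ... | Sign.+ = inj₁ refl
    ... | Sign.- = inj₂ refl

-- Along the left-positive path ε = 1 and c² < N persist. If (c+d)² < N, the
-- left child is negative and the path moves right, to (1, c+d, d). Otherwise it
-- moves left, and with e = (N − c²)/d the new entries are c − e and
-- d′ = d + 2c − e, where N − (c−e)² = e d′ > 0. Hence |c| < N and 0 < d ≤ N at
-- every vertex, so some pair (c, d) recurs, and with it the label (√N + c)/d.
-- Irrationality comes from N not being a square: a rational value of
-- (√N + p)/q would give a rational square root of N, whose denominator is 1.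

module Submission where

open import Defs
open import Data.Nat.Base as ℕ using (ℕ)
open import Data.Integer.Base as ℤ using (ℤ; +_; 0ℤ)
open import Data.Integer.Divisibility.Signed using (_∣_)
open import Data.Product.Base using (_×_)
open import Data.Sign.Base as Sign using (Sign)
open import Algebra.Bundles using (module AbelianGroup)
import Algebra.Properties.Group as GroupProperties
open import Data.Fin.Base using (toℕ; fromℕ<; combine)
open import Data.Fin.Properties
  using (pigeonhole; fromℕ<-injective; combine-injectiveˡ; combine-injectiveʳ)
open import Data.Integer.Divisibility.Signed using (∣⇒∣ᵤ)
import Data.Integer.Properties as ℤ
open import Data.Integer.Tactic.RingSolver using () renaming (solve-∀ to solveℤ)
import Data.Nat.Coprimality as Coprime
import Data.Nat.Divisibility as ℕ
import Data.Nat.Properties as ℕ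
open import Data.Product.Base using (_,_; ∃-syntax; proj₁; proj₂)
open import Data.Rational.Base hiding (_/_)
open import Data.Rational.Properties
open import Data.Rational.Solver using (module +-*-Solver)
import Data.Rational.Unnormalised.Base as ℚᵘ
import Data.Rational.Unnormalised.Properties as ℚᵘ
open import Function.Base using (_∘_)
open import Relation.Nullary using (yes; no; contradiction)
open import Relation.Binary.PropositionalEquality
  using (_≡_; refl; sym; trans; cong; cong₂; subst; subst₂)

open +-*-Solver using (solve; _:+_; _:*_; _:-_; :-_; _:=_; con)
open GroupProperties (AbelianGroup.group ℤ.+-0-abelianGroup) using (∙-cancelʳ)

-- Null sequences of rationals

-- `x ≃ᴿ y` unfolds to `Null` of the termwise difference, so equalities of reals such as `√-square`
-- serve directly as null sequences.
Null : (ℕ → ℚ) → Set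
Null f = ∀ e → 0ℚ < e → ∃[ M ] (∀ n → M ℕ.≤ n → ∣ f n ∣ < e)

-- Eventual agreement is the right hypothesis because `recip` is known to invert the approximations
-- of a positive real only from some index on.
null-cong : ∀ {f g} → ∃[ M ] (∀ n → M ℕ.≤ n → f n ≡ g n) → Null f → Null g
null-cong (M , f≡g) f→0 e e>0 with f→0 e e>0
... | M′ , small = M ℕ.⊔ M′ , λ n M≤n →
  subst (λ z → ∣ z ∣ < e) (f≡g n (joinˡ M≤n)) (small n (joinʳ {M} M≤n))

null-≗ : ∀ {f g} → (∀ n → f n ≡ g n) → Null f → Null g
null-≗ f≡g = null-cong (0 , λ n _ → f≡g n)

null-+ : ∀ {f g} → Null f → Null g → Null (λ n → f n + g n)
null-+ {f} {g} f→0 g→0 e e>0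
  with f→0 (½ * e) (*-pos {½} {e} ½-pos e>0) | g→0 (½ * e) (*-pos {½} {e} ½-pos e>0)
... | M₁ , small₁ | M₂ , small₂ = M₁ ℕ.⊔ M₂ , λ n M≤n →
  ≤-<-trans {∣ f n + g n ∣} {∣ f n ∣ + ∣ g n ∣} {e} (∣p+q∣≤∣p∣+∣q∣ (f n) (g n))
    (subst (∣ f n ∣ + ∣ g n ∣ <_) (half+half e)
      (+-mono-< {∣ f n ∣} {½ * e} {∣ g n ∣} {½ * e} (small₁ n (joinˡ M≤n)) (small₂ n (joinʳ {M₁} M≤n))))

null-neg : ∀ {f} → Null f → Null (λ n → - f n)
null-neg {f} f→0 e e>0 with f→0 e e>0
... | M , small = M , λ n M≤n → subst (_< e) (sym (∣-p∣≡∣p∣ (f n))) (small n M≤n)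

null-* : ∀ x {f} → Null f → Null (λ n → approx x n * f n)
null-* x {f} f→0 e e>0 = close (bounded x)
  where
  close : (∃[ B ] 0ℚ < B × (∃[ M ] (∀ n → M ℕ.≤ n → ∣ approx x n ∣ < B))) →
          ∃[ M ] (∀ n → M ℕ.≤ n → ∣ approx x n * f n ∣ < e)
  close (B , B>0 , M₁ , x<B) = M₁ ℕ.⊔ proj₁ small , λ n M≤n →
    subst (∣ approx x n * f n ∣ <_) cancel
      (*-∣∣-< (approx x n) (f n) {B} {k} B>0 k>0
        (x<B n (joinˡ M≤n)) (proj₂ small n (joinʳ {M₁} M≤n)))
    where
    k = e * (B ⁻¹) B>0
    k>0 : 0ℚ < k
    k>0 = *-pos {e} {(B ⁻¹) B>0} e>0 (⁻¹-pos {B} B>0)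
    small = f→0 k k>0
    cancel : B * k ≡ e
    cancel = trans (solve 3 (λ B e r → B :* (e :* r) := e :* (B :* r)) refl B e ((B ⁻¹) B>0))
      (trans (cong (e *_) (⁻¹-inverse {B} B>0)) (*-identityʳ e))

null-cancel : ∀ {k f} → 0ℚ < k → Null (λ n → k * f n) → Null f
null-cancel {k} {f} k>0 kf→0 = null-≗ cancel (null-* (ℚ→ℝ ((k ⁻¹) k>0)) kf→0)
  where
  cancel : ∀ n → (k ⁻¹) k>0 * (k * f n) ≡ f n
  cancel n = trans (solve 3 (λ r k x → r :* (k :* x) := k :* r :* x) refl ((k ⁻¹) k>0) k (f n))
    (trans (cong (_* f n) (⁻¹-inverse {k} k>0)) (*-identityˡ (f n)))

null-const : ∀ {k} → Null (λ _ → k) → k ≡ 0ℚ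
null-const {k} k→0 with k ≟ 0ℚ
... | yes k≡0 = k≡0
-- Taking the tolerance to be `∣ k ∣` itself forces `∣ k ∣ < ∣ k ∣`.
... | no k≢0 with k→0 ∣ k ∣ (≰⇒> (λ ∣k∣≤0 → k≢0 (∣p∣≡0⇒p≡0 k (≤-antisym ∣k∣≤0 (0≤∣p∣ k)))))
... | M , small = contradiction refl (<⇒≢ (small M ℕ.≤-refl))

-- Labels of the form (√N + c) / d

ℤ→ℚ-- : ∀ y z → ℤ→ℚ (y ℤ.- z) ≡ ℤ→ℚ y - ℤ→ℚ z
ℤ→ℚ-- y z = trans (solve 2 (λ a b → a := (a :+ b) :- b) refl (ℤ→ℚ (y ℤ.- z)) (ℤ→ℚ z))
  (cong (_- ℤ→ℚ z) (trans (sym (ℤ→ℚ-+ (y ℤ.- z) z)) (cong ℤ→ℚ (cancel y z))))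
  where
  cancel : ∀ y z → y ℤ.- z ℤ.+ z ≡ y
  cancel = solveℤ

-- L = (√N + c) / d, multiplied out so that no reciprocal of d occurs.
Represents : (N : ℕ) → ℝ⁺ → (c d : ℤ) → Set
Represents N L c d = Null (λ n → approx (value L) n * ℤ→ℚ d - (√-approx N n + ℤ→ℚ c))

surd-represents : ∀ N p q (p²<N : p ℤ.* p ℤ.< + N) (q>0 : 0ℤ ℤ.< q) →
  Represents N (surd N p q p²<N q>0) p q
surd-represents N p q p²<N q>0 e e>0 = 0 , λ n _ →
  subst (λ z → ∣ z ∣ < e) (sym (exact (√-approx N n + ℤ→ℚ p) (ℤ→ℚ q) (ℤ→ℚ-mono-< {0ℤ} {q} q>0))) e>0
  where
  exact : ∀ a b → 0ℚ < b → a * recip b * b - a ≡ 0ℚ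
  exact a b b>0 = trans (solve 3 (λ a b r → a :* r :* b :- a := a :* (b :* r) :- a) refl a b (recip b))
    (trans (cong (λ z → a * z - a) (recip-inverse {b} b>0))
      (trans (cong (_- a) (*-identityʳ a)) (+-inverseʳ a)))

-- Adding 1 to L and d to c leaves the error term unchanged at every index.
right-represents : ∀ N L c d → Represents N L c d → Represents N (L +⁺ 1⁺) (c ℤ.+ d) d
right-represents N L c d = null-≗ λ n → trans
  (shuffle (approx (value L) n) (ℤ→ℚ d) (√-approx N n) (ℤ→ℚ c))
  (cong (λ z → (approx (value L) n + 1ℚ) * ℤ→ℚ d - (√-approx N n + z)) (sym (ℤ→ℚ-+ c d)))
  where
  shuffle : ∀ L D S C → L * D - (S + C) ≡ (L + 1ℚ) * D - (S + (C + D))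
  shuffle = solve 4 (λ L D S C → L :* D :- (S :+ C) := (L :+ con 1ℚ) :* D :- (S :+ (C :+ D))) refl

-- With N = c² + ed and δ = Ld − (s + c), the error of L/(L+1) as an
-- approximation to (s + c − e) / (d + 2c − e) is governed by s² − N and δ.
left-error : ∀ S C D E L ρ → (L + 1ℚ) * ρ ≡ 1ℚ → let δ = L * D - (S + C) in
  ρ * (- (S * S - (C * C + E * D)) + ((D + C) * δ + - (S * δ))) ≡
  D * (L * ρ * (D + C + C - E) - (S + (C - E)))
left-error S C D E L ρ inverse =
  trans (cong (ρ *_) (expand (L * D) S C D E))
    (trans (collect D L ρ (D + C + C - E) (S + (C - E)))
      (cong (λ z → D * (L * ρ * (D + C + C - E) - z))
        (trans (cong ((S + (C - E)) *_) inverse) (*-identityʳ (S + (C - E))))))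
  where
  expand : ∀ P S C D E →
    - (S * S - (C * C + E * D)) + ((D + C) * (P - (S + C)) + - (S * (P - (S + C)))) ≡
    P * (D + C + C - E) - (S + (C - E)) * (P + D)
  expand = solve 5 (λ P S C D E →
    :- (S :* S :- (C :* C :+ E :* D)) :+ ((D :+ C) :* (P :- (S :+ C)) :+ :- (S :* (P :- (S :+ C)))) :=
    P :* (D :+ C :+ C :- E) :- (S :+ (C :- E)) :* (P :+ D)) refl
  collect : ∀ D L ρ D′ W → ρ * (L * D * D′ - W * (L * D + D)) ≡ D * (L * ρ * D′ - W * ((L + 1ℚ) * ρ))
  collect = solve 5 (λ D L ρ D′ W →
    ρ :* (L :* D :* D′ :- W :* (L :* D :+ D)) := D :* (L :* ρ :* D′ :- W :* ((L :+ con 1ℚ) :* ρ))) refl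

-- The new denominator is ((c+d)² - N)/d, written without a quotient by substituting N = c² + ed. By
-- `left-error`, d times the new error is a bounded multiple of a sum of null terms.
left-represents : ∀ N L c d e → 0ℤ ℤ.< d → + N ≡ c ℤ.* c ℤ.+ e ℤ.* d → Represents N L c d →
  Represents N (L ÷⁺ (L +⁺ 1⁺)) (c ℤ.- e) (d ℤ.+ c ℤ.+ c ℤ.- e)
left-represents N L@(l ,⁺ (η , η>0 , M , η<l)) c d e d>0 N≡ δ→0 =
  null-cancel {D} (ℤ→ℚ-mono-< {0ℤ} {d} d>0)
    -- From `M` on, the approximations of `l` exceed `η`, so `recip` truly inverts
    -- `approx l n + 1ℚ`.
    (null-cong (M , scaled) (null-* (recipᴿ (L +⁺ 1⁺)) error→0))
  where
  C = ℤ→ℚ c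
  D = ℤ→ℚ d
  E = ℤ→ℚ e
  s = √-approx N
  δ : ℕ → ℚ
  δ n = approx l n * D - (s n + C)
  error : ℕ → ℚ
  error n = - (s n * s n - ℤ→ℚ (+ N)) + ((D + C) * δ n + - (s n * δ n))
  error→0 : Null error
  error→0 = null-+ (null-neg (√-square N)) (null-+ (null-* (ℚ→ℝ (D + C)) δ→0) (null-neg (null-* (√ N) δ→0)))
  N′≡ : ℤ→ℚ (+ N) ≡ C * C + E * D
  N′≡ = trans (cong ℤ→ℚ N≡) (trans (ℤ→ℚ-+ (c ℤ.* c) (e ℤ.* d)) (cong₂ _+_ (ℤ→ℚ-* c c) (ℤ→ℚ-* e d)))
  D′≡ : ℤ→ℚ (d ℤ.+ c ℤ.+ c ℤ.- e) ≡ D + C + C - E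
  D′≡ = trans (ℤ→ℚ-- (d ℤ.+ c ℤ.+ c) e) (cong (_- E)
    (trans (ℤ→ℚ-+ (d ℤ.+ c) c) (cong (_+ C) (ℤ→ℚ-+ d c))))
  scaled : ∀ n → M ℕ.≤ n → recip (approx l n + 1ℚ) * error n ≡
    D * (approx l n * recip (approx l n + 1ℚ) * ℤ→ℚ (d ℤ.+ c ℤ.+ c ℤ.- e) - (s n + ℤ→ℚ (c ℤ.- e)))
  scaled n M≤n = trans
    (cong (λ z → ρ * (- (s n * s n - z) + ((D + C) * δ n + - (s n * δ n)))) N′≡)
    (trans (left-error (s n) C D E (approx l n) ρ (recip-inverse {approx l n + 1ℚ} positive′))
      (cong₂ (λ y z → D * (approx l n * ρ * y - (s n + z))) (sym D′≡) (sym (ℤ→ℚ-- c e))))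
    where
    ρ = recip (approx l n + 1ℚ)
    positive′ : 0ℚ < approx l n + 1ℚ
    positive′ = +-pos {approx l n} {1ℚ} (<-trans {0ℚ} {η} {approx l n} η>0 (η<l n M≤n)) 0<1

-- In the difference of the two errors √N + c cancels, leaving d(L - L′).
represents-unique : ∀ N L L′ c d → 0ℤ ℤ.< d → Represents N L c d → Represents N L′ c d → value L ≃ᴿ value L′
represents-unique N L L′ c d d>0 δ→0 δ′→0 = null-cancel {ℤ→ℚ d} (ℤ→ℚ-mono-< {0ℤ} {d} d>0)
  (null-≗ (λ n → difference (approx (value L) n) (approx (value L′) n) (ℤ→ℚ d) (√-approx N n + ℤ→ℚ c))
    (null-+ δ→0 (null-neg δ′→0)))
  where
  difference : ∀ a b D W → (a * D - W) + - (b * D - W) ≡ D * (a - b)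
  difference = solve 4 (λ a b D W → (a :* D :- W) :+ :- (b :* D :- W) := D :* (a :- b)) refl

-- Irrationality

-- In lowest terms a/b, a² = Nb² gives b ∣ a·a. Coprimality yields b ∣ a, and then b, being a common
-- divisor, is 1.
rational-square-root : ∀ N t → t * t ≡ ℤ→ℚ (+ N) → ∃[ k ] N ≡ k ℕ.* k
rational-square-root N t@(mkℚ a b-1 coprime) t²≡N = ℤ.∣ a ∣ , sym a²≡N
  where
  b = ℕ.suc b-1
  cross : toℚᵘ t ℚᵘ.* toℚᵘ t ℚᵘ.≃ ℚᵘ.mkℚᵘ (+ N) 0
  cross = ℚᵘ.≃-trans (ℚᵘ.≃-sym (toℚᵘ-homo-* t t)) (ℚᵘ.≃-trans (toℚᵘ-cong t²≡N) (ratᵘ (+ N) 0))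
  a²≡Nb² : ℤ.∣ a ∣ ℕ.* ℤ.∣ a ∣ ≡ N ℕ.* (b ℕ.* b)
  a²≡Nb² with cross
  ... | ℚᵘ.*≡* eq = trans (sym (ℤ.abs-* a a)) (trans (cong ℤ.∣_∣ (trans (sym (ℤ.*-identityʳ (a ℤ.* a))) eq))
    (ℤ.abs-* (+ N) (+ (b ℕ.* b))))
  b∣a : b ℕ.∣ ℤ.∣ a ∣
  b∣a = Coprime.coprime-divisor (Coprime.sym (Coprime.recompute coprime))
    (ℕ.divides (N ℕ.* b) (trans a²≡Nb² (sym (ℕ.*-assoc N b b))))
  b≡1 : b ≡ 1
  b≡1 = Coprime.recompute coprime (b∣a , ℕ.∣-refl)
  a²≡N : ℤ.∣ a ∣ ℕ.* ℤ.∣ a ∣ ≡ N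
  a²≡N = trans a²≡Nb² (trans (cong (λ z → N ℕ.* (z ℕ.* z)) b≡1) (ℕ.*-identityʳ N))

-- If L = r, the approximations s of √N approach t = rd - c. Then s² - t² = (s + t)(s - t) is null
-- along with s² - N, so the constant t² - N is null, hence 0.
surd-irrational : ∀ N L c d → NonSquare N → Represents N L c d → Irrational (value L)
surd-irrational N L c d nonSquare δ→0 r L≃r = nonSquare (rational-square-root N t
  (trans (solve 2 (λ x y → x := (x :- y) :+ y) refl (t * t) (ℤ→ℚ (+ N)))
    (trans (cong (_+ ℤ→ℚ (+ N)) (null-const t²-N→0)) (+-identityˡ (ℤ→ℚ (+ N))))))
  where
  D = ℤ→ℚ d
  t = r * D - ℤ→ℚ c
  s = √-approx N
  s-t→0 : Null (λ n → s n - t)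
  s-t→0 = null-≗ (λ n → shuffle (approx (value L) n) r D (s n) (ℤ→ℚ c))
    (null-+ (null-* (ℚ→ℝ D) L≃r) (null-neg δ→0))
    where
    shuffle : ∀ l r D s C → D * (l - r) + - (l * D - (s + C)) ≡ s - (r * D - C)
    shuffle = solve 5 (λ l r D s C → D :* (l :- r) :+ :- (l :* D :- (s :+ C)) := s :- (r :* D :- C)) refl
  t²-N→0 : Null (λ _ → t * t - ℤ→ℚ (+ N))
  t²-N→0 = null-≗ (λ n → shuffle (s n) t (ℤ→ℚ (+ N)))
    (null-+ (√-square N) (null-neg (null-* (√ N +ᴿ ℚ→ℝ t) s-t→0)))
    where
    shuffle : ∀ s t N → (s * s - N) + - ((s + t) * (s - t)) ≡ t * t - N
    shuffle = solve 3 (λ s t N → (s :* s :- N) :+ :- ((s :+ t) :* (s :- t)) := t :* t :- N) refl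

-- The invariant along the left-positive path

-- Since ε = 1 is part of the invariant, `Represents` can do without a sign: labels and triples are
-- matched only at vertices of the path.
record Reduced {N : ℕ} (L : ℝ⁺) (T : Triple N) : Set where
  constructor reduced
  open Triple T
  field
    ε≡+        : ε ≡ Sign.+
    c²<N       : c ℤ.* c ℤ.< + N
    represents : Represents N L c d

i<j⇒0<j-i : ∀ {i j} → i ℤ.< j → 0ℤ ℤ.< j ℤ.- i
i<j⇒0<j-i {i} {j} i<j = subst (ℤ._< j ℤ.- i) (ℤ.+-inverseʳ i) (ℤ.+-monoˡ-< (ℤ.- i) i<j)

0<j-i⇒i<j : ∀ {i j} → 0ℤ ℤ.< j ℤ.- i → i ℤ.< j
0<j-i⇒i<j {i} {j} 0<j-i = subst₂ ℤ._<_ (ℤ.+-identityˡ i) (cancel j i) (ℤ.+-monoˡ-< i 0<j-i)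
  where
  cancel : ∀ j i → j ℤ.- i ℤ.+ i ≡ j
  cancel = solveℤ

*-pos-ℤ : ∀ {i j} → 0ℤ ℤ.< i → 0ℤ ℤ.< j → 0ℤ ℤ.< i ℤ.* j
*-pos-ℤ {i} {j} i>0 j>0 = subst (ℤ._< i ℤ.* j) (ℤ.*-zeroʳ i) (ℤ.*-monoˡ-<-pos i {{ℤ.positive i>0}} j>0)

module _ {N : ℕ} (nonSquare : NonSquare N) where

  open Triple

  -- The sign flips only in the branch N - (c+d)² > 0, which is exactly the bound needed after a
  -- right move.
  leftTriple-negative : ∀ T → ε T ≡ Sign.+ → ε (leftTriple nonSquare T) ≡ Sign.- →
    (c T ℤ.+ d T) ℤ.* (c T ℤ.+ d T) ℤ.< + N
  leftTriple-negative (triple .Sign.+ c d d>0 d∣) refl ε≡-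
    with 0ℤ ℤ.<? + N ℤ.- (c ℤ.+ d) ℤ.* (c ℤ.+ d)
  leftTriple-negative _ refl _  | yes >0 = 0<j-i⇒i<j >0
  leftTriple-negative _ refl () | no _

  leftTriple-positive : ∀ T → ε T ≡ Sign.+ → c T ℤ.* c T ℤ.< + N →
    let T′ = leftTriple nonSquare T in ε T′ ≡ Sign.+ →
    ∃[ e ] + N ≡ c T ℤ.* c T ℤ.+ e ℤ.* d T × c T′ ≡ c T ℤ.- e ×
           d T′ ≡ d T ℤ.+ c T ℤ.+ c T ℤ.- e × c T′ ℤ.* c T′ ℤ.< + N
  leftTriple-positive (triple .Sign.+ c d d>0 d∣) refl c²<N ε≡+
    with 0ℤ ℤ.<? + N ℤ.- (c ℤ.+ d) ℤ.* (c ℤ.+ d)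
  leftTriple-positive _ refl _ () | yes _
  -- N - (c-e)² = e d′ is positive: e > 0 because c² < N, and d′ > 0 because a nonsquare N excludes
  -- (c+d)² = N.
  ... | no ≯0 = e , N≡ , refl , d′≡ , 0<j-i⇒i<j (subst (0ℤ ℤ.<_) (sym norm≡) (*-pos-ℤ e>0 d′>0))
    where
    e = div (+ N ℤ.- c ℤ.* c) d d>0
    d′ = div ((c ℤ.+ d) ℤ.* (c ℤ.+ d) ℤ.- + N) d d>0
    d∣′ : d ∣ (c ℤ.+ d) ℤ.* (c ℤ.+ d) ℤ.- + N
    d∣′ = flip-∣ {N} {c} {d} (shift-∣ {N} {c} {d} d∣)
    e>0 : 0ℤ ℤ.< e
    e>0 = div-pos d>0 d∣ (i<j⇒0<j-i c²<N)
    d′>0 : 0ℤ ℤ.< d′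
    d′>0 = div-pos d>0 d∣′ (≯0⇒flip>0 nonSquare (c ℤ.+ d) ≯0)
    norm≡ : + N ℤ.- (c ℤ.- e) ℤ.* (c ℤ.- e) ≡ e ℤ.* d′
    norm≡ = norm′ {N} {c} {d} {e} {d′} d>0 (div-exact d>0 d∣) (div-exact d>0 d∣′)
    N≡ : + N ≡ c ℤ.* c ℤ.+ e ℤ.* d
    N≡ = trans (split (+ N) (c ℤ.* c)) (cong (λ z → c ℤ.* c ℤ.+ z) (div-exact d>0 d∣))
      where
      split : ∀ x y → x ≡ y ℤ.+ (x ℤ.- y)
      split = solveℤ
    d′≡ : d′ ≡ d ℤ.+ c ℤ.+ c ℤ.- e
    d′≡ = ℤ.*-cancelʳ-≡ d′ (d ℤ.+ c ℤ.+ c ℤ.- e) d {{ℤ.>-nonZero d>0}} (trans (sym (div-exact d>0 d∣′))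
      (trans (cong (λ z → (c ℤ.+ d) ℤ.* (c ℤ.+ d) ℤ.- z) N≡) (collect c d e)))
      where
      collect : ∀ c d e → (c ℤ.+ d) ℤ.* (c ℤ.+ d) ℤ.- (c ℤ.* c ℤ.+ e ℤ.* d) ≡ (d ℤ.+ c ℤ.+ c ℤ.- e) ℤ.* d
      collect = solveℤ

  right-reduced : ∀ L T → ε (leftTriple nonSquare T) ≡ Sign.- →
    Reduced L T → Reduced (L +⁺ 1⁺) (rightTriple nonSquare T)
  right-reduced L T ε≡- (reduced ε≡+ _ rep) =
    reduced ε≡+ (leftTriple-negative T ε≡+ ε≡-) (right-represents N L (c T) (d T) rep)

  left-reduced : ∀ L T → ε (leftTriple nonSquare T) ≡ Sign.+ →
    Reduced L T → Reduced (L ÷⁺ (L +⁺ 1⁺)) (leftTriple nonSquare T)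
  left-reduced L T ε′≡+ (reduced ε≡+ c²<N rep) = conclude (leftTriple-positive T ε≡+ c²<N ε′≡+)
    where
    T′ = leftTriple nonSquare T
    conclude : ∃[ e ] + N ≡ c T ℤ.* c T ℤ.+ e ℤ.* d T × c T′ ≡ c T ℤ.- e ×
      d T′ ≡ d T ℤ.+ c T ℤ.+ c T ℤ.- e × c T′ ℤ.* c T′ ℤ.< + N → Reduced (L ÷⁺ (L +⁺ 1⁺)) T′
    conclude (e , N≡ , c′≡ , d′≡ , c′²<N) = reduced ε′≡+ c′²<N
      (subst₂ (Represents N (L ÷⁺ (L +⁺ 1⁺))) (sym c′≡) (sym d′≡)
        (left-represents N L (c T) (d T) e (d>0 T) N≡ rep))

  nextLPP-left : ∀ t v → ε (tripleAt nonSquare t (leftChild v)) ≡ Sign.+ → nextLPP nonSquare t v ≡ leftChild v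
  nextLPP-left t v ε≡+ rewrite ε≡+ = refl

  nextLPP-right : ∀ t v → ε (tripleAt nonSquare t (leftChild v)) ≡ Sign.- → nextLPP nonSquare t v ≡ rightChild v
  nextLPP-right t v ε≡- rewrite ε≡- = refl

  nextLPP-reduced : ∀ α t v → Reduced (label α v) (tripleAt nonSquare t v) →
    Reduced (label α (nextLPP nonSquare t v)) (tripleAt nonSquare t (nextLPP nonSquare t v))
  -- The sign is passed with its equation, so each case can both reduce `nextLPP` and feed the
  -- invariant.
  nextLPP-reduced α t v red = next (ε (tripleAt nonSquare t (leftChild v))) refl
    where
    ReducedAt : Vertex → Set
    ReducedAt w = Reduced (label α w) (tripleAt nonSquare t w)
    next : ∀ s → ε (tripleAt nonSquare t (leftChild v)) ≡ s → ReducedAt (nextLPP nonSquare t v)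
    next Sign.+ ε≡+ = subst ReducedAt (sym (nextLPP-left t v ε≡+))
      (left-reduced (label α v) (tripleAt nonSquare t v) ε≡+ red)
    next Sign.- ε≡- = subst ReducedAt (sym (nextLPP-right t v ε≡-))
      (right-reduced (label α v) (tripleAt nonSquare t v) ε≡- red)

  LPP-reduced : ∀ α t → Reduced α t → ∀ n →
    Reduced (label α (vertex (LPP nonSquare t) n)) (tripleAt nonSquare t (vertex (LPP nonSquare t) n))
  LPP-reduced α t red ℕ.zero    = red
  LPP-reduced α t red (ℕ.suc n) = nextLPP-reduced α t (vertex (LPP nonSquare t) n) (LPP-reduced α t red n)

-- Recurrence of a bounded pair (c, d)

bounded-pair-repeats : ∀ {A B} (f g : ℕ → ℕ) → (∀ n → f n ℕ.< A) → (∀ n → g n ℕ.< B) →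
  ∃[ n ] ∃[ m ] n ℕ.< m × f n ≡ f m × g n ≡ g m
bounded-pair-repeats {A} {B} f g f<A g<B
  -- `combine` codes pairs injectively by A·B values, and the first A·B + 1 indices are used.
  with pigeonhole (ℕ.n<1+n (A ℕ.* B)) (λ i → combine (fromℕ< (f<A (toℕ i))) (fromℕ< (g<B (toℕ i))))
... | i , j , i<j , eq = toℕ i , toℕ j , i<j ,
  fromℕ<-injective _ _ (f<A (toℕ i)) (f<A (toℕ j))
    (combine-injectiveˡ (fromℕ< (f<A (toℕ i))) (fromℕ< (g<B (toℕ i))) (fromℕ< (f<A (toℕ j))) (fromℕ< (g<B (toℕ j))) eq) ,
  fromℕ<-injective _ _ (g<B (toℕ i)) (g<B (toℕ j))
    (combine-injectiveʳ (fromℕ< (f<A (toℕ i))) (fromℕ< (g<B (toℕ i))) (fromℕ< (f<A (toℕ j))) (fromℕ< (g<B (toℕ j))) eq)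

square≥0 : ∀ z → 0ℤ ℤ.≤ z ℤ.* z
square≥0 (+ k)      = subst (0ℤ ℤ.≤_) (ℤ.pos-* k k) (ℤ.+≤+ ℕ.z≤n)
square≥0 ℤ.-[1+ k ] = ℤ.+≤+ ℕ.z≤n

module _ {N : ℕ} {L : ℝ⁺} (T : Triple N) (red : Reduced L T) where
  open Triple T
  open Reduced red

  ∣c∣<N : ℤ.∣ c ∣ ℕ.< N
  ∣c∣<N = ℕ.≤-<-trans (n≤n*n ℤ.∣ c ∣)
    (ℤ.drop‿+<+ (subst (ℤ._< + N) (sym (trans (cong +_ (sym (ℤ.abs-* c c))) (ℤ.0≤i⇒+∣i∣≡i (square≥0 c)))) c²<N))
    where
    n≤n*n : ∀ n → n ℕ.≤ n ℕ.* n
    n≤n*n ℕ.zero    = ℕ.z≤n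
    n≤n*n (ℕ.suc n) = ℕ.m≤m*n (ℕ.suc n) (ℕ.suc n)

  -- The pigeonhole argument needs natural numbers. As c > -N, shifting by N makes c nonnegative, so
  -- that taking the absolute value loses no sign.
  +∣c+N∣≡c+N : + ℤ.∣ c ℤ.+ + N ∣ ≡ c ℤ.+ + N
  +∣c+N∣≡c+N = ℤ.0≤i⇒+∣i∣≡i (shifted≥0 c ∣c∣<N)
    where
    shifted≥0 : ∀ z → ℤ.∣ z ∣ ℕ.< N → 0ℤ ℤ.≤ z ℤ.+ + N
    shifted≥0 (+ _)      _   = ℤ.+≤+ ℕ.z≤n
    shifted≥0 ℤ.-[1+ k ] k<N = subst (0ℤ ℤ.≤_) (sym (ℤ.⊖-≥ (ℕ.<⇒≤ k<N))) (ℤ.+≤+ ℕ.z≤n)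

  ∣c+N∣<N+N : ℤ.∣ c ℤ.+ + N ∣ ℕ.< N ℕ.+ N
  ∣c+N∣<N+N = ℕ.≤-<-trans (ℤ.∣i+j∣≤∣i∣+∣j∣ c (+ N)) (ℕ.+-monoˡ-< N ∣c∣<N)

  +∣d∣≡d : + ℤ.∣ d ∣ ≡ d
  +∣d∣≡d = ℤ.0≤i⇒+∣i∣≡i (ℤ.<⇒≤ d>0)

  -- d divides N - c², which is positive and at most N.
  ∣d∣≤N : ℤ.∣ d ∣ ℕ.≤ N
  ∣d∣≤N = ℕ.≤-trans (ℕ.∣⇒≤ {{ℤ.≢-nonZero (ℤ.<⇒≢ N-c²>0 ∘ sym)}} (∣⇒∣ᵤ d∣N-c²)) ∣N-c²∣≤N
    where
    N-c²>0 = i<j⇒0<j-i c²<N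
    ∣N-c²∣≤N : ℤ.∣ + N ℤ.- c ℤ.* c ∣ ℕ.≤ N
    ∣N-c²∣≤N = ℤ.drop‿+≤+ (subst (ℤ._≤ + N) (sym (ℤ.0≤i⇒+∣i∣≡i (ℤ.<⇒≤ N-c²>0)))
      (ℤ.i-j≤i (+ N) (c ℤ.* c) {{ℤ.nonNegative (square≥0 c)}}))

LPP-irrationality : ∀ {N} (nonSquare : NonSquare N) α t → Reduced α t →
  IsIrrationalityPath α (LPP nonSquare t)
LPP-irrationality {N} nonSquare α t red = conclude (bounded-pair-repeats
  (λ n → ℤ.∣ c n ℤ.+ + N ∣) (λ n → ℤ.∣ d n ∣)
  (λ n → ∣c+N∣<N+N (T n) (R n)) (λ n → ℕ.s≤s (∣d∣≤N (T n) (R n))))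
  where
  P = vertex (LPP nonSquare t)
  T : ℕ → Triple N
  T n = tripleAt nonSquare t (P n)
  R : ∀ n → Reduced (label α (P n)) (T n)
  R = LPP-reduced nonSquare α t red
  c d : ℕ → ℤ
  c n = Triple.c (T n)
  d n = Triple.d (T n)
  conclude : ∃[ n ] ∃[ m ] n ℕ.< m × ℤ.∣ c n ℤ.+ + N ∣ ≡ ℤ.∣ c m ℤ.+ + N ∣ × ℤ.∣ d n ∣ ≡ ℤ.∣ d m ∣ →
    IsIrrationalityPath α (LPP nonSquare t)
  conclude (n , m , n<m , ∣c+N∣≡ , ∣d∣≡) = n , m , n<m ,
    represents-unique N (label α (P n)) (label α (P m)) (c m) (d m) (Triple.d>0 (T m))
      (subst₂ (Represents N (label α (P n))) c≡ d≡ (Reduced.represents (R n)))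
      (Reduced.represents (R m))
    where
    c≡ : c n ≡ c m
    c≡ = ∙-cancelʳ (+ N) (c n) (c m) (trans (sym (+∣c+N∣≡c+N (T n) (R n)))
      (trans (cong +_ ∣c+N∣≡) (+∣c+N∣≡c+N (T m) (R m))))
    d≡ : d n ≡ d m
    d≡ = trans (sym (+∣d∣≡d (T n) (R n))) (trans (cong +_ ∣d∣≡) (+∣d∣≡d (T m) (R m)))

corollary1 : (N : ℕ) → 0 ℕ.< N → (nonSquare : NonSquare N) →
    (p : ℤ) (p²<N : p ℤ.* p ℤ.< + N) →
    (q : ℤ) (q>0 : 0ℤ ℤ.< q) (q∣N-p² : q ∣ + N ℤ.- p ℤ.* p) →
    let α = surd N p q p²<N q>0 in
    IsIrrationalityPath α (LPP nonSquare (triple Sign.+ p q q>0 q∣N-p²)) × Irrational (value α)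
corollary1 N _ nonSquare p p²<N q q>0 q∣N-p² =
  LPP-irrationality nonSquare α (triple Sign.+ p q q>0 q∣N-p²) (reduced refl p²<N α-represents) ,
  surd-irrational N α p q nonSquare α-represents
  where
  α = surd N p q p²<N q>0
  α-represents : Represents N α p q
  α-represents = surd-represents N p q p²<N q>0
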